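{- Let $x_0\ge1$ be an integer, with associated word $w$ and real constant $K$. Assume that for every rational $\vartheta\in(0,1)$, every set $T\subseteq\mathcal{V}_{\mathbb{R}}(K,\vartheta)$ whose elements have pairwise distinct gaps (i.e. $c-a\ne c'-a'$ for any two distinct elements $(a,c),(a',c')$ of $T$) is finite. If $K$ is algebraic, then for every $C\in\mathbb{N}$ there is an integer $m\ge1$ with $P(w,m)>Cm$.
   Context: For an integer $x_0\ge 1$ define the orbit $(x_n)_{n\ge0}$ by $x_{n+1}=\lceil 3x_n/2\rceil$ for $n\ge 0$. The associated word is $w=(w_n)_{n\ge 0}$ with $w_n=2x_{n+1}-3x_n\in\{0,1\}$, equivalently $w_n=x_n \bmod 2$. The associated real constant is $K=x_0+\frac13\sum_{j\ge0}w_j(2/3)^j$, equivalently $K=\lim_{n\to\infty}x_n(2/3)^n$. The complexity $P(w,m)$ is the number of distinct vectors $(w_j,w_{j+1},\dots,w_{j+m-1})$ as $j$ ranges over all non-negative integers. For real $x$, $\lVert x\rVert$ denotes the distance from $x$ to the nearest integer. For real $\delta$ and rational $\vartheta$, with $\mathbb{N}=\{0,1,2,\dots\}$, $$\mathcal{V}_{\mathbb{R}}(\delta,\vartheta)=\Bigl\{(a,c)\in\mathbb{N}^2:\ 2\le a<c,\ \bigl\lVert\delta\bigl((3/2)^c-(3/2)^a\bigr)\bigr\rVert\le\vartheta^{\,c}\Bigr\}.$$ The gap of $(a,c)$ is $c-a$. -}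

module Defs where

open import Data.Bool.Base using (true; false)
open import Data.Fin.Base using (Fin; toℕ; inject≤)
import Data.Fin.Properties as Fin
open import Data.Integer.Base as ℤ using (ℤ; +_)
import Data.Integer.DivMod as ℤ
import Data.Integer.Properties as ℤ
open import Data.List.Base using (List; []; _∷_)
open import Data.List.Membership.Propositional using (_∈_)
open import Data.List.Relation.Unary.Any using (Any)
open import Data.Nat.Base as ℕ using (ℕ; zero; suc; ⌈_/2⌉)
import Data.Nat.Properties as ℕ
open import Data.Product using (∃; ∃-syntax; _×_; _,_; proj₁; proj₂)
open import Data.Rational.Base
open import Data.Rational.Properties
open import Data.Rational.Solver using (module +-*-Solver)
import Data.Rational.Unnormalised.Base as ℚᵘ
import Data.Rational.Unnormalised.Properties as ℚᵘ
open import Data.Sum.Base using (_⊎_; inj₁; inj₂)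
open import Data.Vec.Base using (Vec; tabulate)
open import Function.Definitions using (Injective)
open import Function.Bundles using (_⇔_; mk⇔; Equivalence)
open import Level using (0ℓ)
open import Relation.Binary.Definitions using (tri<; tri≈; tri>)
open import Relation.Binary.PropositionalEquality
open import Relation.Unary using (Pred)

open import Algebra.Definitions.RawSemiring +-*-rawSemiring public using (_^_)

∣-∣≤ : ∀ {p e} → p ≤ e → - p ≤ e → ∣ p ∣ ≤ e
∣-∣≤ {p} p≤e -p≤e with ∣p∣≡p∨∣p∣≡-p p
... | inj₁ eq = subst (_≤ _) (sym eq) p≤e
... | inj₂ eq = subst (_≤ _) (sym eq) -p≤e

p≤∣p∣ : ∀ p → p ≤ ∣ p ∣
p≤∣p∣ p with ≤-total 0ℚ p
... | inj₁ 0≤p = ≤-reflexive (sym (0≤p⇒∣p∣≡p 0≤p))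
... | inj₂ p≤0 = ≤-trans p≤0 (0≤∣p∣ p)

-p≤∣p∣ : ∀ p → - p ≤ ∣ p ∣
-p≤∣p∣ p = subst (- p ≤_) (∣-p∣≡∣p∣ p) (p≤∣p∣ (- p))

∣-∣-swap : ∀ p q → ∣ p - q ∣ ≡ ∣ q - p ∣
∣-∣-swap p q = trans (sym (∣-p∣≡∣p∣ (p - q))) (cong ∣_∣
  (solve 2 (λ a b → :- (a :- b) := b :- a) refl p q))
  where open +-*-Solver

half+half : ∀ p → p * ½ + p * ½ ≡ p
half+half p = trans (sym (*-distribˡ-+ p ½ ½)) (*-identityʳ p)

0<*½ : ∀ {p} → 0ℚ < p → 0ℚ < p * ½
0<*½ {p} 0<p = subst (_< p * ½) (*-zeroˡ ½) (*-monoˡ-<-pos ½ 0<p)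

fromℤ : ℤ → ℚ
fromℤ i = i / 1

toℚᵘ-fromℤ : ∀ i → toℚᵘ (fromℤ i) ℚᵘ.≃ ℚᵘ.mkℚᵘ i 0
toℚᵘ-fromℤ i = toℚᵘ-fromℚᵘ (ℚᵘ.mkℚᵘ i 0)

fromℤ-mono : ∀ {i j} → i ℤ.≤ j → fromℤ i ≤ fromℤ j
fromℤ-mono {i} {j} i≤j = toℚᵘ-cancel-≤ (begin
  toℚᵘ (fromℤ i) ≃⟨ toℚᵘ-fromℤ i ⟩
  ℚᵘ.mkℚᵘ i 0    ≤⟨ ℚᵘ.*≤* (ℤ.*-monoʳ-≤-nonNeg (+ 1) i≤j) ⟩
  ℚᵘ.mkℚᵘ j 0    ≃⟨ toℚᵘ-fromℤ j ⟨
  toℚᵘ (fromℤ j) ∎)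
  where open ℚᵘ.≤-Reasoning

fromℤ-suc : ∀ i → fromℤ (ℤ.suc i) ≡ fromℤ i + 1ℚ
fromℤ-suc i = toℚᵘ-injective (begin
  toℚᵘ (fromℤ (ℤ.suc i))      ≈⟨ toℚᵘ-fromℤ (ℤ.suc i) ⟩
  ℚᵘ.mkℚᵘ (ℤ.suc i) 0         ≈⟨ ℚᵘ.*≡* (cong (ℤ._* + 1) eq) ⟩
  ℚᵘ.mkℚᵘ i 0 ℚᵘ.+ ℚᵘ.1ℚᵘ     ≈⟨ ℚᵘ.+-congˡ ℚᵘ.1ℚᵘ (toℚᵘ-fromℤ i) ⟨
  toℚᵘ (fromℤ i) ℚᵘ.+ ℚᵘ.1ℚᵘ  ≈⟨ toℚᵘ-homo-+ (fromℤ i) 1ℚ ⟨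
  toℚᵘ (fromℤ i + 1ℚ)         ∎)
  where
  open import Relation.Binary.Reasoning.Setoid ℚᵘ.≃-setoid
  eq : ℤ.suc i ≡ i ℤ.* + 1 ℤ.+ + 1 ℤ.* + 1
  eq = trans (ℤ.+-comm (+ 1) i) (cong (ℤ._+ + 1) (sym (ℤ.*-identityʳ i)))

floor≤ : ∀ p → fromℤ (floor p) ≤ p
floor≤ p@record{} = toℚᵘ-cancel-≤ (begin
  toℚᵘ (fromℤ (floor p)) ≃⟨ toℚᵘ-fromℤ (floor p) ⟩
  ℚᵘ.mkℚᵘ (floor p) 0    ≤⟨ ℚᵘ.*≤* (subst (floor p ℤ.* ↧ p ℤ.≤_) (sym (ℤ.*-identityʳ (↥ p)))
                              (ℤ.[n/d]*d≤n (↥ p) (↧ p))) ⟩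
  toℚᵘ p                 ∎)
  where open ℚᵘ.≤-Reasoning

<floor+1 : ∀ p → p < fromℤ (floor p) + 1ℚ
<floor+1 p@record{} = subst (p <_) (fromℤ-suc (floor p)) (toℚᵘ-cancel-< (begin-strict
  toℚᵘ p                         <⟨ ℚᵘ.*<* (subst (ℤ._< ℤ.suc (floor p) ℤ.* ↧ p)
                                      (sym (ℤ.*-identityʳ (↥ p))) num) ⟩
  ℚᵘ.mkℚᵘ (ℤ.suc (floor p)) 0    ≃⟨ toℚᵘ-fromℤ (ℤ.suc (floor p)) ⟨
  toℚᵘ (fromℤ (ℤ.suc (floor p))) ∎))
  where
  open ℚᵘ.≤-Reasoning
  num : ↥ p ℤ.< ℤ.suc (floor p) ℤ.* ↧ p
  num = subst₂ ℤ._<_ (sym (ℤ.a≡a%n+[a/n]*n (↥ p) (↧ p))) (sym (ℤ.suc-* (floor p) (↧ p)))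
          (ℤ.+-monoˡ-< (floor p ℤ.* ↧ p) (ℤ.+<+ (ℤ.n%d<d (↥ p) (↧ p))))

fromℤ-neg : ∀ i → fromℤ (ℤ.- i) ≡ - fromℤ i
fromℤ-neg i = toℚᵘ-injective (begin
  toℚᵘ (fromℤ (ℤ.- i))    ≈⟨ toℚᵘ-fromℤ (ℤ.- i) ⟩
  ℚᵘ.- ℚᵘ.mkℚᵘ i 0        ≈⟨ ℚᵘ.-‿cong (toℚᵘ-fromℤ i) ⟨
  ℚᵘ.- toℚᵘ (fromℤ i)     ≈⟨ toℚᵘ-homo‿- (fromℤ i) ⟨
  toℚᵘ (- fromℤ i)        ∎)
  where open import Relation.Binary.Reasoning.Setoid ℚᵘ.≃-setoid

ceiling≡ : ∀ p → ceiling p ≡ ℤ.- floor (- p)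
ceiling≡ record{} = refl

∣p-round∣≤½ : ∀ p → ∣ p - fromℤ (round p) ∣ ≤ ½
∣p-round∣≤½ p with p ≤ᵇ 0ℚ
... | true = subst (λ z → ∣ p - z ∣ ≤ ½) (sym c≡-f) (∣-∣≤
  (subst₂ _≤_ (solve 3 (λ a h f → (a :- h) :+ (f :+ h) := a :- (:- f)) refl p ½ f)
    (solve 2 (λ a h → :- (:- (a :- h)) :- (a :- h) :+ h := h) refl p ½)
    up)
  (subst₂ _≤_ (solve 3 (λ a h f → :- (a :- h) :- (f :+ h) := :- (a :- (:- f))) refl p ½ f)
    (solve 3 (λ f h o → (f :+ o) :- (f :+ h) := o :- h) refl f ½ 1ℚ)
    (+-monoˡ-≤ (- (f + ½)) (<⇒≤ (<floor+1 (- (p - ½)))))))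
  where
  open +-*-Solver
  f = fromℤ (floor (- (p - ½)))
  c≡-f : fromℤ (ceiling (p - ½)) ≡ - f
  c≡-f = trans (cong fromℤ (ceiling≡ (p - ½))) (fromℤ-neg (floor (- (p - ½))))
  up : (p - ½) + (f + ½) ≤ - (- (p - ½)) - (p - ½) + ½
  up = subst₂ _≤_
    (solve 3 (λ a h f → f :+ ((a :- h) :+ h) := (a :- h) :+ (f :+ h)) refl p ½ f)
    (solve 2 (λ a h → :- (a :- h) :+ ((a :- h) :+ h) := :- (:- (a :- h)) :- (a :- h) :+ h) refl p ½)
    (+-monoˡ-≤ ((p - ½) + ½) (floor≤ (- (p - ½))))
... | false = ∣-∣≤
  (subst₂ _≤_ (solve 3 (λ a h f → (a :+ h) :- (f :+ h) := a :- f) refl p ½ f)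
    (solve 3 (λ f h o → (f :+ o) :- (f :+ h) := o :- h) refl f ½ 1ℚ)
    (+-monoˡ-≤ (- (f + ½)) (<⇒≤ (<floor+1 (p + ½)))))
  (subst₂ _≤_ (solve 2 (λ a f → f :- a := :- (a :- f)) refl p f)
    (solve 2 (λ a h → (a :+ h) :- a := h) refl p ½)
    (+-monoˡ-≤ (- p) (floor≤ (p + ½))))
  where
  open +-*-Solver
  f = fromℤ (floor (p + ½))

‖_‖ℚ : ℚ → ℚ
‖ p ‖ℚ = ∣ p - fromℤ (round p) ∣

‖‖ℚ-nearest : ∀ p i → ‖ p ‖ℚ ≤ ∣ p - fromℤ i ∣
‖‖ℚ-nearest p i with ℤ.<-cmp i (round p)
... | tri≈ _ i≡n _ = ≤-reflexive (cong (λ z → ∣ p - fromℤ z ∣) (sym i≡n))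
... | tri< i<n _ _ = ≤-trans (∣p-round∣≤½ p) (≤-trans
  (subst₂ _≤_
    (solve 3 (λ i h x → (x :+ (i :+ (h :+ h))) :+ :- (h :+ x :+ i) := h) refl (fromℤ i) ½ (- (p - n)))
    (solve 4 (λ p n i h → (h :+ n) :+ :- (h :+ (:- (p :- n)) :+ i) := p :- i) refl p n (fromℤ i) ½)
    (+-monoˡ-≤ (- (½ + - (p - n) + fromℤ i)) (+-mono-≤ -d≤½ i+1≤n)))
  (p≤∣p∣ _))
  where
  open +-*-Solver
  n = fromℤ (round p)
  -d≤½ = ≤-trans (-p≤∣p∣ (p - n)) (∣p-round∣≤½ p)
  i+1≤n : fromℤ i + 1ℚ ≤ n
  i+1≤n = subst (_≤ n) (fromℤ-suc i) (fromℤ-mono (ℤ.i<j⇒suc[i]≤j i<n))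
... | tri> _ _ n<i = ≤-trans (∣p-round∣≤½ p) (≤-trans
  (subst₂ _≤_
    (solve 3 (λ n h x → (x :+ (n :+ (h :+ h))) :+ :- (h :+ x :+ n) := h) refl n ½ (p - n))
    (solve 4 (λ p n i h → (h :+ i) :+ :- (h :+ (p :- n) :+ n) := :- (p :- i)) refl p n (fromℤ i) ½)
    (+-monoˡ-≤ (- (½ + (p - n) + n)) (+-mono-≤ d≤½ n+1≤i)))
  (-p≤∣p∣ _))
  where
  open +-*-Solver
  n = fromℤ (round p)
  d≤½ = ≤-trans (p≤∣p∣ (p - n)) (∣p-round∣≤½ p)
  n+1≤i : n + 1ℚ ≤ fromℤ i
  n+1≤i = subst (_≤ fromℤ i) (fromℤ-suc (round p)) (fromℤ-mono (ℤ.i<j⇒suc[i]≤j n<i))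

‖‖ℚ-diff : ∀ p q → ‖ p ‖ℚ - ‖ q ‖ℚ ≤ ∣ p - q ∣
‖‖ℚ-diff p q = subst (‖ p ‖ℚ - ‖ q ‖ℚ ≤_)
  (solve 2 (λ a b → (a :+ b) :- b := a) refl ∣ p - q ∣ ‖ q ‖ℚ)
  (+-monoˡ-≤ (- ‖ q ‖ℚ) (≤-trans (‖‖ℚ-nearest p (round q))
    (subst (λ z → ∣ z ∣ ≤ ∣ p - q ∣ + ‖ q ‖ℚ)
      (solve 3 (λ p q n → (p :- q) :+ (q :- n) := p :- n) refl p q (fromℤ (round q)))
      (∣p+q∣≤∣p∣+∣q∣ (p - q) (q - fromℤ (round q))))))
  where open +-*-Solver

‖‖ℚ-lipschitz : ∀ p q → ∣ ‖ p ‖ℚ - ‖ q ‖ℚ ∣ ≤ ∣ p - q ∣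
‖‖ℚ-lipschitz p q = ∣-∣≤ (‖‖ℚ-diff p q)
  (subst₂ _≤_ (solve 2 (λ a b → b :- a := :- (a :- b)) refl ‖ p ‖ℚ ‖ q ‖ℚ)
    (∣-∣-swap q p) (‖‖ℚ-diff q p))
  where open +-*-Solver

record ℝ : Set where
  constructor mkℝ
  field
    seq    : ℕ → ℚ
    cauchy : ∀ ε → 0ℚ < ε → ∃[ N ] ∀ m n → N ℕ.≤ m → N ℕ.≤ n → ∣ seq m - seq n ∣ ≤ ε

open ℝ public

infix 4 _≈ʳ_ _≤ʳ_

_≈ʳ_ : ℝ → ℝ → Set
x ≈ʳ y = ∀ ε → 0ℚ < ε → ∃[ N ] ∀ n → N ℕ.≤ n → ∣ seq x n - seq y n ∣ ≤ ε

_≤ʳ_ : ℝ → ℝ → Set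
x ≤ʳ y = ∀ ε → 0ℚ < ε → ∃[ N ] ∀ n → N ℕ.≤ n → seq x n ≤ seq y n + ε

fromℚ : ℚ → ℝ
fromℚ p .seq _ = p
fromℚ p .cauchy ε 0<ε = 0 , λ _ _ _ _ →
  subst (_≤ ε) (cong ∣_∣ (sym (+-inverseʳ p))) (<⇒≤ 0<ε)

infixl 6 _+ʳ_
infixl 7 _*ʳ_

_+ʳ_ : ℝ → ℝ → ℝ
(x +ʳ y) .seq n = seq x n + seq y n
(x +ʳ y) .cauchy ε 0<ε with cauchy x (ε * ½) (0<*½ 0<ε) | cauchy y (ε * ½) (0<*½ 0<ε)
... | M , hx | N , hy = M ℕ.⊔ N , λ m n m≥ n≥ →
  subst₂ _≤_
    (cong ∣_∣ (solve 4 (λ a b c d → (a :- b) :+ (c :- d) := (a :+ c) :- (b :+ d)) refl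
      (seq x m) (seq x n) (seq y m) (seq y n)))
    (half+half ε)
    (≤-trans (∣p+q∣≤∣p∣+∣q∣ (seq x m - seq x n) (seq y m - seq y n))
      (+-mono-≤ (hx m n (ℕ.m⊔n≤o⇒m≤o M N m≥) (ℕ.m⊔n≤o⇒m≤o M N n≥))
                (hy m n (ℕ.m⊔n≤o⇒n≤o M N m≥) (ℕ.m⊔n≤o⇒n≤o M N n≥))))
  where open +-*-Solver

eventually-bounded : ∀ x → ∃[ B ] Positive B × ∃[ N ] ∀ n → N ℕ.≤ n → ∣ seq x n ∣ ≤ B
eventually-bounded x with cauchy x 1ℚ (positive⁻¹ 1ℚ)
... | N , h = 1ℚ + ∣ seq x N ∣
            , pos+nonNeg⇒pos 1ℚ ∣ seq x N ∣ {{∣-∣-nonNeg (seq x N)}}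
            , N , λ n n≥ → subst (_≤ 1ℚ + ∣ seq x N ∣)
                (cong ∣_∣ (solve 2 (λ a b → (a :- b) :+ b := a) refl (seq x n) (seq x N)))
                (≤-trans (∣p+q∣≤∣p∣+∣q∣ (seq x n - seq x N) (seq x N))
                  (+-monoˡ-≤ ∣ seq x N ∣ (h n N n≥ ℕ.≤-refl)))
  where open +-*-Solver

shrink : ∀ B ε → Positive B → 0ℚ < ε → ∃[ δ ] 0ℚ < δ × B * δ ≡ ε
shrink B ε B>0 0<ε = 1/B * ε
  , positive⁻¹ (1/B * ε) {{pos*pos⇒pos 1/B {{1/pos⇒pos B {{B>0}}}} ε {{positive 0<ε}}}}
  , trans (sym (*-assoc B 1/B ε))
      (trans (cong (_* ε) (*-inverseʳ B {{pos⇒nonZero B {{B>0}}}})) (*-identityˡ ε))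
  where 1/B = (1/ B) {{pos⇒nonZero B {{B>0}}}}

∣*∣≤ : ∀ p q {a b} → Positive a → ∣ p ∣ ≤ a → ∣ q ∣ ≤ b → ∣ p * q ∣ ≤ a * b
∣*∣≤ p q {a} {b} a>0 ∣p∣≤a ∣q∣≤b = subst (_≤ a * b) (sym (∣p*q∣≡∣p∣*∣q∣ p q)) (≤-trans
  (*-monoʳ-≤-nonNeg ∣ q ∣ {{∣-∣-nonNeg q}} ∣p∣≤a)
  (*-monoˡ-≤-nonNeg a {{pos⇒nonNeg a {{a>0}}}} ∣q∣≤b))

*-diff : ∀ a b c d → a * (c - d) + d * (a - b) ≡ a * c - b * d
*-diff a b c d = solve 4 (λ a b c d → a :* (c :- d) :+ d :* (a :- b) := a :* c :- b :* d) refl a b c d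
  where open +-*-Solver

*-diff-≤ : ∀ a b c d {A B α β ε} → Positive A → Positive B →
           A * α ≡ ε * ½ → B * β ≡ ε * ½ →
           ∣ a ∣ ≤ A → ∣ d ∣ ≤ B → ∣ c - d ∣ ≤ α → ∣ a - b ∣ ≤ β →
           ∣ a * c - b * d ∣ ≤ ε
*-diff-≤ a b c d {ε = ε} A>0 B>0 Aα≡ Bβ≡ a≤ d≤ c-d≤ a-b≤ = subst₂ _≤_
  (cong ∣_∣ (*-diff a b c d))
  (trans (cong₂ _+_ Aα≡ Bβ≡) (half+half ε))
  (≤-trans (∣p+q∣≤∣p∣+∣q∣ (a * (c - d)) (d * (a - b)))
    (+-mono-≤ (∣*∣≤ a (c - d) A>0 a≤ c-d≤) (∣*∣≤ d (a - b) B>0 d≤ a-b≤)))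

_*ʳ_ : ℝ → ℝ → ℝ
(x *ʳ y) .seq n = seq x n * seq y n
(x *ʳ y) .cauchy ε 0<ε =
  let A , A>0 , I , hA = eventually-bounded x
      B , B>0 , J , hB = eventually-bounded y
      α , α>0 , Aα≡ = shrink A (ε * ½) A>0 (0<*½ 0<ε)
      β , β>0 , Bβ≡ = shrink B (ε * ½) B>0 (0<*½ 0<ε)
      M , hx = cauchy x β β>0
      N , hy = cauchy y α α>0
  in (I ℕ.⊔ J) ℕ.⊔ (M ℕ.⊔ N) , λ m n m≥ n≥ →
    let I≤m = ℕ.m⊔n≤o⇒m≤o I J (ℕ.m⊔n≤o⇒m≤o (I ℕ.⊔ J) (M ℕ.⊔ N) m≥)
        J≤n = ℕ.m⊔n≤o⇒n≤o I J (ℕ.m⊔n≤o⇒m≤o (I ℕ.⊔ J) (M ℕ.⊔ N) n≥)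
        MN≤m = ℕ.m⊔n≤o⇒n≤o (I ℕ.⊔ J) (M ℕ.⊔ N) m≥
        MN≤n = ℕ.m⊔n≤o⇒n≤o (I ℕ.⊔ J) (M ℕ.⊔ N) n≥
    in *-diff-≤ (seq x m) (seq x n) (seq y m) (seq y n) A>0 B>0 Aα≡ Bβ≡ (hA m I≤m) (hB n J≤n)
         (hy m n (ℕ.m⊔n≤o⇒n≤o M N MN≤m) (ℕ.m⊔n≤o⇒n≤o M N MN≤n))
         (hx m n (ℕ.m⊔n≤o⇒m≤o M N MN≤m) (ℕ.m⊔n≤o⇒m≤o M N MN≤n))

‖_‖ : ℝ → ℝ
‖ x ‖ .seq n = ‖ seq x n ‖ℚ
‖ x ‖ .cauchy ε 0<ε with cauchy x ε 0<ε
... | N , h = N , λ m n m≥ n≥ → ≤-trans (‖‖ℚ-lipschitz (seq x m) (seq x n)) (h m n m≥ n≥)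

-- A polynomial over ℚ is its list of coefficients, constant term first.
eval : List ℚ → ℝ → ℝ
eval []       x = fromℚ 0ℚ
eval (a ∷ as) x = fromℚ a +ʳ x *ʳ eval as x

Algebraic : ℝ → Set
Algebraic x = ∃[ as ] Any (_≢ 0ℚ) as × eval as x ≈ʳ fromℚ 0ℚ

orbit : ℕ → ℕ → ℕ
orbit x₀ zero    = x₀
orbit x₀ (suc n) = ⌈ 3 ℕ.* orbit x₀ n /2⌉

word : ℕ → ℕ → ℕ
word x₀ n = 2 ℕ.* orbit x₀ (suc n) ℕ.∸ 3 ℕ.* orbit x₀ n

2*⌈n/2⌉-bounds : ∀ n → n ℕ.≤ 2 ℕ.* ⌈ n /2⌉ × 2 ℕ.* ⌈ n /2⌉ ℕ.≤ suc n
2*⌈n/2⌉-bounds zero          = ℕ.z≤n , ℕ.z≤n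
2*⌈n/2⌉-bounds (suc zero)    = ℕ.s≤s ℕ.z≤n , ℕ.≤-refl
2*⌈n/2⌉-bounds (suc (suc n)) with 2*⌈n/2⌉-bounds n
... | l , u = subst (suc (suc n) ℕ.≤_) eq (ℕ.s≤s (ℕ.s≤s l))
            , subst (ℕ._≤ suc (suc (suc n))) eq (ℕ.s≤s (ℕ.s≤s u))
  where
  eq : 2 ℕ.+ 2 ℕ.* ⌈ n /2⌉ ≡ 2 ℕ.* suc ⌈ n /2⌉
  eq = sym (ℕ.*-suc 2 ⌈ n /2⌉)

-- The truncated subtraction in `word` never truncates.
word-step : ∀ x₀ n → 2 ℕ.* orbit x₀ (suc n) ≡ 3 ℕ.* orbit x₀ n ℕ.+ word x₀ n
word-step x₀ n = sym (ℕ.m+[n∸m]≡n (proj₁ (2*⌈n/2⌉-bounds (3 ℕ.* orbit x₀ n))))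

word≤1 : ∀ x₀ n → word x₀ n ℕ.≤ 1
word≤1 x₀ n = ℕ.m≤n+o⇒m∸n≤o (2 ℕ.* orbit x₀ (suc n)) (3 ℕ.* orbit x₀ n)
  (subst (2 ℕ.* orbit x₀ (suc n) ℕ.≤_) (ℕ.+-comm 1 (3 ℕ.* orbit x₀ n))
    (proj₂ (2*⌈n/2⌉-bounds (3 ℕ.* orbit x₀ n))))

fromℕ : ℕ → ℚ
fromℕ n = fromℤ (+ n)

⅓ ⅔ : ℚ
⅓ = + 1 / 3
⅔ = + 2 / 3

partialSum : (ℕ → ℚ) → ℕ → ℚ
partialSum f zero    = 0ℚ
partialSum f (suc n) = partialSum f n + f n

K-seq : ℕ → ℕ → ℚ
K-seq x₀ n = fromℕ x₀ + ⅓ * partialSum (λ j → fromℕ (word x₀ j) * ⅔ ^ j) n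

⅔^-nonNeg : ∀ n → NonNegative (⅔ ^ n)
⅔^-nonNeg zero    = _
⅔^-nonNeg (suc n) = nonNeg*nonNeg⇒nonNeg ⅔ (⅔ ^ n) {{⅔^-nonNeg n}}

ramp : ℕ → ℚ
ramp zero    = 1ℚ
ramp (suc n) = ramp n + ½

1≤ramp : ∀ n → 1ℚ ≤ ramp n
1≤ramp zero    = ≤-refl
1≤ramp (suc n) = subst (_≤ ramp n + ½) (+-identityʳ 1ℚ)
  (+-mono-≤ (1≤ramp n) (nonNegative⁻¹ ½))

⅔^n*ramp≤1 : ∀ n → ⅔ ^ n * ramp n ≤ 1ℚ
⅔^n*ramp≤1 zero    = ≤-refl
⅔^n*ramp≤1 (suc n) = ≤-trans
  (subst₂ _≤_
    (solve 4 (λ t r h p → p :* (t :* r :+ t :* h) := (t :* p) :* (r :+ h)) refl ⅔ (ramp n) ½ (⅔ ^ n))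
    (cong (⅔ ^ n *_) (trans (sym (*-distribʳ-+ (ramp n) ⅔ ⅓)) (*-identityˡ (ramp n))))
    (*-monoˡ-≤-nonNeg (⅔ ^ n) {{⅔^-nonNeg n}}
      (+-monoʳ-≤ (⅔ * ramp n) (*-monoˡ-≤-nonNeg ⅓ (1≤ramp n)))))
  (⅔^n*ramp≤1 n)
  where open +-*-Solver

ramp-double : ∀ k → fromℕ k ≤ ramp (k ℕ.+ k)
ramp-double zero    = nonNegative⁻¹ 1ℚ
ramp-double (suc k) = subst₂ _≤_ (sym (fromℤ-suc (+ k)))
  (trans (sym (+-assoc (ramp (k ℕ.+ k)) ½ ½)) (cong (λ j → ramp (suc j)) (sym (ℕ.+-suc k k))))
  (+-monoˡ-≤ 1ℚ (ramp-double k))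

1≤↧*p : ∀ p → 0ℚ < p → 1ℚ ≤ fromℕ (↧ₙ p) * p
1≤↧*p (mkℚ ℤ.-[1+ _ ] _ _) 0<p with () ← positive 0<p
1≤↧*p (mkℚ (+ zero) _ _) 0<p with () ← positive 0<p
1≤↧*p p@(mkℚ (+ suc a) d _) _ = toℚᵘ-cancel-≤ (begin
  ℚᵘ.1ℚᵘ                              ≤⟨ ℚᵘ.*≤* (ℤ.+≤+ le) ⟩
  ℚᵘ.mkℚᵘ (+ suc d) 0 ℚᵘ.* toℚᵘ p     ≃⟨ ℚᵘ.*-congʳ (toℚᵘ-fromℤ (+ suc d)) ⟨
  toℚᵘ (fromℕ (suc d)) ℚᵘ.* toℚᵘ p    ≃⟨ toℚᵘ-homo-* (fromℕ (suc d)) p ⟨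
  toℚᵘ (fromℕ (suc d) * p)            ∎)
  where
  open ℚᵘ.≤-Reasoning
  le : suc (d ℕ.+ 0 ℕ.+ 0) ℕ.≤ suc d ℕ.* suc a ℕ.* 1
  le = subst₂ ℕ._≤_
    (cong suc (sym (trans (ℕ.+-identityʳ (d ℕ.+ 0)) (ℕ.+-identityʳ d))))
    (sym (ℕ.*-identityʳ (suc d ℕ.* suc a)))
    (ℕ.m≤m*n (suc d) (suc a))

⅔^-small : ∀ ε → 0ℚ < ε → ∃[ N ] ⅔ ^ N ≤ ε
⅔^-small ε 0<ε = N , ≤-trans
  (subst₂ _≤_ (*-identityʳ _) refl (*-monoˡ-≤-nonNeg (⅔ ^ N) {{⅔^-nonNeg N}} (1≤↧*p ε 0<ε)))
  (subst₂ _≤_ (*-assoc (⅔ ^ N) (fromℕ d) ε) (*-identityˡ ε)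
    (*-monoʳ-≤-nonNeg ε {{pos⇒nonNeg ε {{positive 0<ε}}}}
      (≤-trans (*-monoˡ-≤-nonNeg (⅔ ^ N) {{⅔^-nonNeg N}} (ramp-double d)) (⅔^n*ramp≤1 N))))
  where
  d = ↧ₙ ε
  N = d ℕ.+ d

K-step : ∀ x₀ n → K-seq x₀ n ≤ K-seq x₀ (suc n)
                × K-seq x₀ (suc n) + ⅔ ^ suc n ≤ K-seq x₀ n + ⅔ ^ n
K-step x₀ n =
    subst₂ _≤_ (+-identityʳ k) shape (+-monoʳ-≤ k (nonNegative⁻¹ t {{t≥0}}))
  , subst₂ _≤_ (cong (_+ ⅔ ^ suc n) shape)
      (trans (+-assoc k (⅓ * ⅔ ^ n) (⅔ * ⅔ ^ n))
        (cong (λ z → k + z) (trans (sym (*-distribʳ-+ (⅔ ^ n) ⅓ ⅔)) (*-identityˡ (⅔ ^ n)))))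
      (+-monoˡ-≤ (⅔ ^ suc n) (+-monoʳ-≤ k (*-monoˡ-≤-nonNeg ⅓ w*≤)))
  where
  open +-*-Solver
  instance _ = ⅔^-nonNeg n
  k = K-seq x₀ n
  w = fromℕ (word x₀ n)
  w≥0 : NonNegative w
  w≥0 = nonNegative (fromℤ-mono {+ 0} {+ word x₀ n} (ℤ.+≤+ ℕ.z≤n))
  t = ⅓ * (w * ⅔ ^ n)
  t≥0 : NonNegative t
  t≥0 = nonNeg*nonNeg⇒nonNeg ⅓ (w * ⅔ ^ n) {{nonNeg*nonNeg⇒nonNeg w {{w≥0}} (⅔ ^ n)}}
  w*≤ : w * ⅔ ^ n ≤ ⅔ ^ n
  w*≤ = subst (w * ⅔ ^ n ≤_) (*-identityˡ (⅔ ^ n))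
    (*-monoʳ-≤-nonNeg (⅔ ^ n) (fromℤ-mono {+ word x₀ n} {+ 1} (ℤ.+≤+ (word≤1 x₀ n))))
  shape : k + t ≡ K-seq x₀ (suc n)
  shape = solve 4 (λ x c s u → (x :+ c :* s) :+ c :* u := x :+ c :* (s :+ u)) refl
    (fromℕ x₀) ⅓ (partialSum (λ j → fromℕ (word x₀ j) * ⅔ ^ j) n) (w * ⅔ ^ n)

p≤p+q : ∀ p q → NonNegative q → p ≤ p + q
p≤p+q p q q≥0 = subst (_≤ p + q) (+-identityʳ p) (+-monoʳ-≤ p (nonNegative⁻¹ q {{q≥0}}))

mono-ℕ : (f : ℕ → ℚ) → (∀ n → f n ≤ f (suc n)) → ∀ {m n} → m ℕ.≤′ n → f m ≤ f n
mono-ℕ f step ℕ.≤′-refl                 = ≤-refl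
mono-ℕ f step {m} (ℕ.≤′-step {n} m≤n) = ≤-trans (mono-ℕ f step m≤n) (step n)

antimono-ℕ : (f : ℕ → ℚ) → (∀ n → f (suc n) ≤ f n) → ∀ {m n} → m ℕ.≤′ n → f n ≤ f m
antimono-ℕ f step ℕ.≤′-refl                 = ≤-refl
antimono-ℕ f step {m} (ℕ.≤′-step {n} m≤n) = ≤-trans (step n) (antimono-ℕ f step m≤n)

K-lower : ∀ x₀ N n → N ℕ.≤ n → K-seq x₀ N ≤ K-seq x₀ n
K-lower x₀ N n N≤n = mono-ℕ (K-seq x₀) (λ k → proj₁ (K-step x₀ k)) (ℕ.≤⇒≤′ N≤n)

K-upper : ∀ x₀ N n → N ℕ.≤ n → K-seq x₀ n ≤ K-seq x₀ N + ⅔ ^ N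
K-upper x₀ N n N≤n = ≤-trans (p≤p+q (K-seq x₀ n) (⅔ ^ n) (⅔^-nonNeg n))
  (antimono-ℕ (λ k → K-seq x₀ k + ⅔ ^ k) (λ k → proj₂ (K-step x₀ k)) (ℕ.≤⇒≤′ N≤n))

∣-∣≤-range : ∀ a e {p q} → a ≤ p → p ≤ a + e → a ≤ q → q ≤ a + e → ∣ p - q ∣ ≤ e
∣-∣≤-range a e {p} {q} a≤p p≤ a≤q q≤ = ∣-∣≤ (diff p≤ a≤q)
  (subst (_≤ e) (solve 2 (λ p q → q :- p := :- (p :- q)) refl p q) (diff q≤ a≤p))
  where
  open +-*-Solver
  diff : ∀ {p q} → p ≤ a + e → a ≤ q → p - q ≤ e
  diff {p} {q} p≤ a≤q = subst (p - q ≤_)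
    (solve 2 (λ a b → (a :+ b) :- a := b) refl a e)
    (+-mono-≤ p≤ (neg-antimono-≤ a≤q))

-- The sequence of partial sums of x₀ + ⅓ Σ wⱼ (2/3)ʲ.
K : ℕ → ℝ
K x₀ .seq = K-seq x₀
K x₀ .cauchy ε 0<ε =
  let N , small = ⅔^-small ε 0<ε
  in N , λ m n m≥ n≥ →
    ≤-trans (∣-∣≤-range (K-seq x₀ N) (⅔ ^ N)
      (K-lower x₀ N m m≥) (K-upper x₀ N m m≥) (K-lower x₀ N n n≥) (K-upper x₀ N n n≥)) small

MoreThan : ∀ {A : Set} → ℕ → Pred A 0ℓ → Set
MoreThan {A} N S = ∃[ f ] Injective {A = Fin (suc N)} {B = A} _≡_ _≡_ f × (∀ i → S (f i))

HasCardinality : ∀ {A : Set} → Pred A 0ℓ → ℕ → Set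
HasCardinality {A} S p =
  ∃[ f ] Injective {A = Fin p} {B = A} _≡_ _≡_ f × (∀ a → S a ⇔ (∃[ i ] f i ≡ a))

-- `MoreThan N S` says that S has more than N elements even when the
-- cardinality of S cannot be computed; it agrees with it when it can.
moreThan⇔ : ∀ {A : Set} {S : Pred A 0ℓ} {p} N → HasCardinality S p → MoreThan N S ⇔ N ℕ.< p
moreThan⇔ {A} {S} {p} N (f , f-inj , f-enum) = mk⇔ to from
  where
  to : MoreThan N S → N ℕ.< p
  to (g , g-inj , g∈S) = Fin.injective⇒≤ {f = index} λ {i} {j} eq →
    g-inj (trans (sym (f-index i)) (trans (cong f eq) (f-index j)))
    where
    hit : ∀ i → ∃[ k ] f k ≡ g i
    hit i = Equivalence.to (f-enum (g i)) (g∈S i)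
    index : Fin (suc N) → Fin p
    index i = proj₁ (hit i)
    f-index : ∀ i → f (index i) ≡ g i
    f-index i = proj₂ (hit i)
  from : N ℕ.< p → MoreThan N S
  from N<p = (λ i → f (inject≤ i N<p))
           , (λ eq → Fin.inject≤-injective N<p N<p _ _ (f-inj eq))
           , (λ i → Equivalence.from (f-enum _) (inject≤ i N<p , refl))

-- The list may contain elements outside S: classically this is finiteness, and
-- it does not require S to be decidable.
Finite : ∀ {A : Set} → Pred A 0ℓ → Set
Finite {A} S = ∃[ xs ] ∀ {a : A} → S a → a ∈ xs

factor : (ℕ → ℕ) → ∀ m → ℕ → Vec ℕ m
factor w m j = tabulate λ i → w (j ℕ.+ toℕ i)

Factors : (ℕ → ℕ) → ∀ m → Pred (Vec ℕ m) 0ℓ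
Factors w m v = ∃[ j ] v ≡ factor w m j

-- P(w , m) > N, where P(w , m) is the cardinality of `Factors w m`.
ComplexityExceeds : (ℕ → ℕ) → ℕ → ℕ → Set
ComplexityExceeds w m N = MoreThan N (Factors w m)

𝒱 : ℝ → ℚ → Pred (ℕ × ℕ) 0ℓ
𝒱 δ ϑ (a , c) = 2 ℕ.≤ a × a ℕ.< c
  × ‖ δ *ʳ fromℚ ((+ 3 / 2) ^ c - (+ 3 / 2) ^ a) ‖ ≤ʳ fromℚ (ϑ ^ c)

gap : ℕ × ℕ → ℕ
gap (a , c) = c ℕ.∸ a

PairwiseDistinctGaps : Pred (ℕ × ℕ) 0ℓ → Set
PairwiseDistinctGaps T = ∀ {s t} → T s → T t → s ≢ t → gap s ≢ gap t

{-# OPTIONS --safe #-}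
-- If P(w, m) ≤ C m, two of the factors of length m at the positions 2, …, C m + 2 coincide,
-- at positions a < c say.  Since (3/2)^n K = x_n + ⅓ Σ w_{n+j} (2/3)^j, this puts
-- K ((3/2)^c − (3/2)^a) within (2/3)^m of an integer, and (2/3)^m ≤ ϑ^c for a ϑ < 1
-- depending only on C.  The gap can be made arbitrarily large: a long run of small period d
-- also has every small multiple of d as a period.  A sequence of such pairs of increasing
-- gap contradicts the hypothesis, without recourse to a Ridout-type theorem for bounded gaps.
-- Coincidence of factors is decidable, so the argument is constructive.

module Submission where

open import Defs
open import Data.Nat.Base using (ℕ; _≤_; _*_)
open import Data.Product using (_×_; ∃-syntax)
open import Data.Rational.Base using (ℚ; 0ℚ; 1ℚ) renaming (_<_ to _<ℚ_)
open import Level using (0ℓ)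
open import Relation.Unary using (Pred; _⊆_)

open import Algebra.Bundles using (CommutativeRing)
open import Data.Fin.Base using (toℕ; fromℕ<)
import Data.Fin.Properties as Fin
open import Data.Integer.Base as ℤ using (ℤ; +_)
import Data.Integer.Properties as ℤ
open import Data.List.Membership.Propositional using (_∈_)
import Data.List.Relation.Unary.All as All
open import Data.Nat.Base using (zero; suc; _+_; _∸_; _<_; z≤n; s≤s; _<′_; ≤′-refl; ≤′-step; >-nonZero; ⌈_/2⌉)
import Data.Nat.Properties as ℕ
open import Data.List.Extrema ℕ.≤-totalOrder using (argmax; f[xs]≤f[argmax])
open import Data.Nat.Solver using () renaming (module +-*-Solver to ℕ-Solver)
open import Data.Product using (_,_; proj₁; proj₂)
open import Data.Rational.Base using (∣_∣; toℚᵘ; _/_; Positive; NonNegative; nonNegative)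
  renaming (_+_ to _+ℚ_; _*_ to _*ℚ_; _-_ to _-ℚ_; -_ to -ℚ_; _≤_ to _≤ℚ_)
import Data.Rational.Properties as ℚ
open import Data.Rational.Solver using () renaming (module +-*-Solver to ℚ-Solver)
import Data.Rational.Unnormalised.Base as ℚᵘ
import Data.Rational.Unnormalised.Properties as ℚᵘ
open import Data.Sum.Base as Sum using (_⊎_; inj₁; inj₂)
open import Data.Vec.Base using (lookup)
import Data.Vec.Properties as Vec
open import Relation.Binary.Definitions using (tri<; tri≈; tri>)
open import Relation.Binary.PropositionalEquality
open import Relation.Nullary using (Dec; yes; no; contradiction)
open import Relation.Nullary.Decidable using (_×-dec_)

open import Algebra.Properties.CommutativeSemiring.Exp
  (CommutativeRing.commutativeSemiring ℚ.+-*-commutativeRing)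
  using (^-homo-*; ^-assocʳ; ^-distrib-*)

-- Embedding of integers and naturals into the rationals.

fromℤ-+ : ∀ i j → fromℤ (i ℤ.+ j) ≡ fromℤ i +ℚ fromℤ j
fromℤ-+ i j = ℚ.toℚᵘ-injective (begin
  toℚᵘ (fromℤ (i ℤ.+ j))               ≈⟨ toℚᵘ-fromℤ (i ℤ.+ j) ⟩
  ℚᵘ.mkℚᵘ (i ℤ.+ j) 0                  ≈⟨ ℚᵘ.*≡* (cong (ℤ._* + 1)
                                            (cong₂ ℤ._+_ (ℤ.*-identityʳ i) (ℤ.*-identityʳ j))) ⟨
  ℚᵘ.mkℚᵘ i 0 ℚᵘ.+ ℚᵘ.mkℚᵘ j 0         ≈⟨ ℚᵘ.+-cong (toℚᵘ-fromℤ i) (toℚᵘ-fromℤ j) ⟨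
  toℚᵘ (fromℤ i) ℚᵘ.+ toℚᵘ (fromℤ j)   ≈⟨ ℚ.toℚᵘ-homo-+ (fromℤ i) (fromℤ j) ⟨
  toℚᵘ (fromℤ i +ℚ fromℤ j)            ∎)
  where open import Relation.Binary.Reasoning.Setoid ℚᵘ.≃-setoid

fromℕ-* : ∀ m n → fromℕ (m * n) ≡ fromℕ m *ℚ fromℕ n
fromℕ-* zero    n = sym (ℚ.*-zeroˡ (fromℕ n))
fromℕ-* (suc m) n = begin
  fromℕ (n + m * n)                   ≡⟨ fromℤ-+ (+ n) (+ (m * n)) ⟩
  fromℕ n +ℚ fromℕ (m * n)            ≡⟨ cong (fromℕ n +ℚ_) (fromℕ-* m n) ⟩
  fromℕ n +ℚ fromℕ m *ℚ fromℕ n       ≡⟨ solve 2 (λ m n → n :+ m :* n := (m :+ con 1ℚ) :* n)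
                                            refl (fromℕ m) (fromℕ n) ⟩
  (fromℕ m +ℚ 1ℚ) *ℚ fromℕ n          ≡⟨ cong (_*ℚ fromℕ n) (fromℤ-suc (+ m)) ⟨
  fromℕ (suc m) *ℚ fromℕ n            ∎
  where
  open ≡-Reasoning
  open ℚ-Solver

fromℕ-nonNeg : ∀ n → NonNegative (fromℕ n)
fromℕ-nonNeg n = nonNegative (fromℤ-mono {+ 0} {+ n} (ℤ.+≤+ z≤n))

-- Closed form of the partial sums of K, and their shifts.

orbit-orbit : ∀ x c j → orbit (orbit x c) j ≡ orbit x (j + c)
orbit-orbit x c zero    = refl
orbit-orbit x c (suc j) = cong (λ y → ⌈ 3 * y /2⌉) (orbit-orbit x c j)

word-orbit : ∀ x c j → word (orbit x c) j ≡ word x (j + c)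
word-orbit x c j = cong₂ (λ y z → 2 * y ∸ 3 * z) (orbit-orbit x c (suc j)) (orbit-orbit x c j)

⅔*orbit : ∀ x n → ⅔ *ℚ fromℕ (orbit x (suc n)) ≡ fromℕ (orbit x n) +ℚ ⅓ *ℚ fromℕ (word x n)
⅔*orbit x n = begin
  ⅔ *ℚ fromℕ z                    ≡⟨ ℚ.*-assoc ⅓ (fromℕ 2) (fromℕ z) ⟩
  ⅓ *ℚ (fromℕ 2 *ℚ fromℕ z)       ≡⟨ cong (⅓ *ℚ_) (fromℕ-* 2 z) ⟨
  ⅓ *ℚ fromℕ (2 * z)              ≡⟨ cong (λ k → ⅓ *ℚ fromℕ k) (word-step x n) ⟩
  ⅓ *ℚ fromℕ (3 * y + w)          ≡⟨ cong (⅓ *ℚ_) (fromℤ-+ (+ (3 * y)) (+ w)) ⟩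
  ⅓ *ℚ (fromℕ (3 * y) +ℚ fromℕ w) ≡⟨ cong (λ k → ⅓ *ℚ (k +ℚ fromℕ w)) (fromℕ-* 3 y) ⟩
  ⅓ *ℚ (fromℕ 3 *ℚ fromℕ y +ℚ fromℕ w)
                                  ≡⟨ solve 2 (λ y w → con ⅓ :* (con (fromℕ 3) :* y :+ w) := y :+ con ⅓ :* w)
                                       refl (fromℕ y) (fromℕ w) ⟩
  fromℕ y +ℚ ⅓ *ℚ fromℕ w         ∎
  where
  open ≡-Reasoning
  open ℚ-Solver
  y = orbit x n
  z = orbit x (suc n)
  w = word x n

-- The sum telescopes: by the recurrence divided by 3, the term w_n (2/3)^n / 3 is the increment of
-- x_n (2/3)^n. Both descriptions of K therefore agree at every finite stage.
K-seq≡ : ∀ x n → K-seq x n ≡ fromℕ (orbit x n) *ℚ ⅔ ^ n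
K-seq≡ x zero    = trans (ℚ.+-identityʳ (fromℕ x)) (sym (ℚ.*-identityʳ (fromℕ x)))
K-seq≡ x (suc n) = begin
  fromℕ x +ℚ ⅓ *ℚ (s +ℚ w *ℚ p)       ≡⟨ solve 5 (λ x t s w p →
                                            x :+ t :* (s :+ w :* p) := (x :+ t :* s) :+ (t :* w) :* p)
                                            refl (fromℕ x) ⅓ s w p ⟩
  K-seq x n +ℚ (⅓ *ℚ w) *ℚ p          ≡⟨ cong (_+ℚ (⅓ *ℚ w) *ℚ p) (K-seq≡ x n) ⟩
  y *ℚ p +ℚ (⅓ *ℚ w) *ℚ p             ≡⟨ ℚ.*-distribʳ-+ p y (⅓ *ℚ w) ⟨
  (y +ℚ ⅓ *ℚ w) *ℚ p                  ≡⟨ cong (_*ℚ p) (⅔*orbit x n) ⟨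
  (⅔ *ℚ z) *ℚ p                       ≡⟨ solve 3 (λ t z p → (t :* z) :* p := z :* (t :* p)) refl ⅔ z p ⟩
  z *ℚ (⅔ *ℚ p)                       ∎
  where
  open ≡-Reasoning
  open ℚ-Solver
  p = ⅔ ^ n
  s = partialSum (λ j → fromℕ (word x j) *ℚ ⅔ ^ j) n
  w = fromℕ (word x n)
  y = fromℕ (orbit x n)
  z = fromℕ (orbit x (suc n))

1^n≡1 : ∀ n → 1ℚ ^ n ≡ 1ℚ
1^n≡1 zero    = refl
1^n≡1 (suc n) = trans (ℚ.*-identityˡ (1ℚ ^ n)) (1^n≡1 n)

-- By the closed form both sides are x_(k+c) (2/3)^k. Multiplication by (3/2)^c restarts the orbit
-- at x_c, with no limit involved.
K-seq-orbit : ∀ x c k → K-seq x (k + c) *ℚ (+ 3 / 2) ^ c ≡ K-seq (orbit x c) k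
K-seq-orbit x c k = begin
  K-seq x (k + c) *ℚ t^c         ≡⟨ cong (_*ℚ t^c) (K-seq≡ x (k + c)) ⟩
  (y *ℚ ⅔ ^ (k + c)) *ℚ t^c      ≡⟨ cong (λ p → (y *ℚ p) *ℚ t^c) (^-homo-* ⅔ k c) ⟩
  (y *ℚ (⅔ ^ k *ℚ ⅔ ^ c)) *ℚ t^c ≡⟨ solve 4 (λ y p q r → (y :* (p :* q)) :* r := (y :* p) :* (q :* r))
                                      refl y (⅔ ^ k) (⅔ ^ c) t^c ⟩
  (y *ℚ ⅔ ^ k) *ℚ (⅔ ^ c *ℚ t^c) ≡⟨ cong ((y *ℚ ⅔ ^ k) *ℚ_) (^-distrib-* ⅔ (+ 3 / 2) c) ⟨
  (y *ℚ ⅔ ^ k) *ℚ 1ℚ ^ c         ≡⟨ cong ((y *ℚ ⅔ ^ k) *ℚ_) (1^n≡1 c) ⟩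
  (y *ℚ ⅔ ^ k) *ℚ 1ℚ             ≡⟨ ℚ.*-identityʳ (y *ℚ ⅔ ^ k) ⟩
  y *ℚ ⅔ ^ k                     ≡⟨ cong (λ z → fromℕ z *ℚ ⅔ ^ k) (orbit-orbit x c k) ⟨
  fromℕ (orbit (orbit x c) k) *ℚ ⅔ ^ k ≡⟨ K-seq≡ (orbit x c) k ⟨
  K-seq (orbit x c) k            ∎
  where
  open ≡-Reasoning
  open ℚ-Solver
  y = fromℕ (orbit x (k + c))
  t^c = (+ 3 / 2) ^ c

-- Repeated factors and the distance to the nearest integer.

Agree : (ℕ → ℕ) → ℕ → ℕ → ℕ → Set
Agree w a b L = ∀ i → i < L → w (i + a) ≡ w (i + b)

Agree-≤ : ∀ {w a b L M} → L ≤ M → Agree w a b M → Agree w a b L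
Agree-≤ L≤M agree i i<L = agree i (ℕ.≤-trans i<L L≤M)

partialSum-cong : ∀ {f g} n → (∀ i → i < n → f i ≡ g i) → partialSum f n ≡ partialSum g n
partialSum-cong zero    eq = refl
partialSum-cong (suc n) eq =
  cong₂ _+ℚ_ (partialSum-cong n (λ i i<n → eq i (ℕ.m<n⇒m<1+n i<n))) (eq n ℕ.≤-refl)

tail : ℕ → ℕ → ℚ
tail x n = ⅓ *ℚ partialSum (λ j → fromℕ (word x j) *ℚ ⅔ ^ j) n

-- Whatever the truncation n, the letters beyond the first L weigh at most the sum of (2/3)^j / 3
-- over j ≥ L, which is (2/3)^L. The bounds are those for `K-seq`, which unfolds to `fromℕ x` plus
-- `tail`.
tail-bounds : ∀ x L n → L ≤ n → tail x L ≤ℚ tail x n × tail x n ≤ℚ tail x L +ℚ ⅔ ^ L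
tail-bounds x L n L≤n =
    cancel (K-lower x L n L≤n)
  , cancel (subst (K-seq x n ≤ℚ_) (ℚ.+-assoc (fromℕ x) (tail x L) (⅔ ^ L)) (K-upper x L n L≤n))
  where
  open ℚ-Solver
  cancel : ∀ {p q} → fromℕ x +ℚ p ≤ℚ fromℕ x +ℚ q → p ≤ℚ q
  cancel {p} {q} le = subst₂ _≤ℚ_ (simp p) (simp q) (ℚ.+-monoʳ-≤ (-ℚ fromℕ x) le)
    where
    simp : ∀ p → -ℚ fromℕ x +ℚ (fromℕ x +ℚ p) ≡ p
    simp = solve 2 (λ x p → :- x :+ (x :+ p) := p) refl (fromℕ x)

tail-agree : ∀ x a c L → Agree (word x) a c L → tail (orbit x a) L ≡ tail (orbit x c) L
tail-agree x a c L agree = cong (⅓ *ℚ_) (partialSum-cong L λ i i<L →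
  cong (λ v → fromℕ v *ℚ ⅔ ^ i)
    (trans (word-orbit x a i) (trans (agree i i<L) (sym (word-orbit x c i)))))

-- (3/2)^c K − x_c is the tail ⅓ Σ w_{c+j} (2/3)^j, so the nearest-integer error is
-- the difference of two tails with a common beginning.
agree⇒near : ∀ x a c L n → Agree (word x) a c L → L + a ≤ n → L + c ≤ n →
             ‖ K-seq x n *ℚ ((+ 3 / 2) ^ c -ℚ (+ 3 / 2) ^ a) ‖ℚ ≤ℚ ⅔ ^ L
agree⇒near x a c L n agree L+a≤n L+c≤n = ℚ.≤-trans
  (‖‖ℚ-nearest (K-seq x n *ℚ ((+ 3 / 2) ^ c -ℚ (+ 3 / 2) ^ a)) (+ xc ℤ.- + xa))
  (subst (λ z → ∣ z ∣ ≤ℚ ⅔ ^ L) (sym difference)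
    (∣-∣≤-range (tail xc L) (⅔ ^ L) (proj₁ c-bounds) (proj₂ c-bounds)
      (subst (_≤ℚ tail xa l) same (proj₁ a-bounds))
      (subst (λ t → tail xa l ≤ℚ t +ℚ ⅔ ^ L) same (proj₂ a-bounds))))
  where
  open ≡-Reasoning
  open ℚ-Solver
  xa = orbit x a
  xc = orbit x c
  k = n ∸ c
  l = n ∸ a
  same = tail-agree x a c L agree
  c-bounds = tail-bounds xc L k (ℕ.m+n≤o⇒m≤o∸n L L+c≤n)
  a-bounds = tail-bounds xa L l (ℕ.m+n≤o⇒m≤o∸n L L+a≤n)
  scaled : ∀ d → L + d ≤ n → K-seq x n *ℚ (+ 3 / 2) ^ d ≡ fromℕ (orbit x d) +ℚ tail (orbit x d) (n ∸ d)
  scaled d L+d≤n = trans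
    (cong (λ m → K-seq x m *ℚ (+ 3 / 2) ^ d) (sym (ℕ.m∸n+n≡m (ℕ.m+n≤o⇒n≤o L L+d≤n))))
    (K-seq-orbit x d (n ∸ d))
  integer : fromℤ (+ xc ℤ.- + xa) ≡ fromℕ xc -ℚ fromℕ xa
  integer = trans (fromℤ-+ (+ xc) (ℤ.- + xa)) (cong (fromℕ xc +ℚ_) (fromℤ-neg (+ xa)))
  difference : K-seq x n *ℚ ((+ 3 / 2) ^ c -ℚ (+ 3 / 2) ^ a) -ℚ fromℤ (+ xc ℤ.- + xa)
             ≡ tail xc k -ℚ tail xa l
  difference = begin
    K-seq x n *ℚ ((+ 3 / 2) ^ c -ℚ (+ 3 / 2) ^ a) -ℚ fromℤ (+ xc ℤ.- + xa)
      ≡⟨ cong₂ _-ℚ_ (solve 3 (λ κ p q → κ :* (p :- q) := κ :* p :- κ :* q)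
           refl (K-seq x n) ((+ 3 / 2) ^ c) ((+ 3 / 2) ^ a)) integer ⟩
    (K-seq x n *ℚ (+ 3 / 2) ^ c -ℚ K-seq x n *ℚ (+ 3 / 2) ^ a) -ℚ (fromℕ xc -ℚ fromℕ xa)
      ≡⟨ cong₂ (λ u v → (u -ℚ v) -ℚ (fromℕ xc -ℚ fromℕ xa)) (scaled c L+c≤n) (scaled a L+a≤n) ⟩
    ((fromℕ xc +ℚ tail xc k) -ℚ (fromℕ xa +ℚ tail xa l)) -ℚ (fromℕ xc -ℚ fromℕ xa)
      ≡⟨ solve 4 (λ p q r s → ((p :+ q) :- (r :+ s)) :- (p :- r) := q :- s)
           refl (fromℕ xc) (tail xc k) (fromℕ xa) (tail xa l) ⟩
    tail xc k -ℚ tail xa l ∎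

-- The base ϑ and membership in `𝒱`.

^-nonNeg : ∀ p .{{_ : NonNegative p}} n → NonNegative (p ^ n)
^-nonNeg p zero    = _
^-nonNeg p (suc n) = ℚ.nonNeg*nonNeg⇒nonNeg p (p ^ n) {{^-nonNeg p n}}

^-monoˡ-≤ : ∀ {p q} .{{_ : NonNegative p}} .{{_ : NonNegative q}} → p ≤ℚ q → ∀ n → p ^ n ≤ℚ q ^ n
^-monoˡ-≤ p≤q zero    = ℚ.≤-refl
^-monoˡ-≤ {p} {q} p≤q (suc n) = ℚ.≤-trans
  (ℚ.*-monoʳ-≤-nonNeg (p ^ n) {{^-nonNeg p n}} p≤q)
  (ℚ.*-monoˡ-≤-nonNeg q (^-monoˡ-≤ p≤q n))

^-antimonoʳ-≤ : ∀ {p} .{{_ : NonNegative p}} → p ≤ℚ 1ℚ → ∀ {m n} → m ≤ n → p ^ n ≤ℚ p ^ m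
^-antimonoʳ-≤ {p} p≤1 m≤n = antimono-ℕ (p ^_)
  (λ n → subst (p ^ suc n ≤ℚ_) (ℚ.*-identityˡ (p ^ n)) (ℚ.*-monoʳ-≤-nonNeg (p ^ n) {{^-nonNeg p n}} p≤1))
  (ℕ.≤⇒≤′ m≤n)

bernoulli : ∀ {δ} → 0ℚ ≤ℚ δ → δ ≤ℚ 1ℚ → ∀ n → 1ℚ -ℚ fromℕ n *ℚ δ ≤ℚ (1ℚ -ℚ δ) ^ n
bernoulli {δ} 0≤δ δ≤1 zero    = ℚ.≤-reflexive (cong (λ z → 1ℚ -ℚ z) (ℚ.*-zeroˡ δ))
bernoulli {δ} 0≤δ δ≤1 (suc n) = begin
  1ℚ -ℚ fromℕ (suc n) *ℚ δ               ≡⟨ cong (λ k → 1ℚ -ℚ k *ℚ δ) (fromℤ-suc (+ n)) ⟩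
  1ℚ -ℚ (fromℕ n +ℚ 1ℚ) *ℚ δ             ≤⟨ p≤p+q _ _ square ⟩
  1ℚ -ℚ (fromℕ n +ℚ 1ℚ) *ℚ δ +ℚ fromℕ n *ℚ (δ *ℚ δ)
                                         ≡⟨ solve 2 (λ n d → con 1ℚ :- (n :+ con 1ℚ) :* d :+ n :* (d :* d)
                                              := (con 1ℚ :- d) :* (con 1ℚ :- n :* d)) refl (fromℕ n) δ ⟩
  (1ℚ -ℚ δ) *ℚ (1ℚ -ℚ fromℕ n *ℚ δ)      ≤⟨ ℚ.*-monoˡ-≤-nonNeg (1ℚ -ℚ δ) (bernoulli 0≤δ δ≤1 n) ⟩
  (1ℚ -ℚ δ) *ℚ (1ℚ -ℚ δ) ^ n             ∎
  where
  open ℚ.≤-Reasoning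
  open ℚ-Solver
  instance
    1-δ≥0 : NonNegative (1ℚ -ℚ δ)
    1-δ≥0 = nonNegative (subst (_≤ℚ 1ℚ -ℚ δ) (ℚ.+-inverseʳ δ) (ℚ.+-monoˡ-≤ (-ℚ δ) δ≤1))
    δ≥0 : NonNegative δ
    δ≥0 = nonNegative 0≤δ
    n≥0 = fromℕ-nonNeg n
  square : NonNegative (fromℕ n *ℚ (δ *ℚ δ))
  square = ℚ.nonNeg*nonNeg⇒nonNeg (fromℕ n) (δ *ℚ δ) {{ℚ.nonNeg*nonNeg⇒nonNeg δ δ}}

-- Take ϑ = 1 - δ with δ = 1/(3(e + 1)). Bernoulli's inequality gives ϑ^(e + 1) ≥ 1 - 1/3 = 2/3, and
-- raising this to the power L suffices for every c up to (e + 1) L.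
∃-base : ∀ e → ∃[ ϑ ] (0ℚ <ℚ ϑ × ϑ <ℚ 1ℚ × ∀ L c → c ≤ suc e * L → ⅔ ^ L ≤ℚ ϑ ^ c)
∃-base e = ϑ , 0<ϑ , ϑ<1 , bound
  where
  open ℚ-Solver
  D>0 : Positive (fromℕ (suc e))
  D>0 = subst Positive (sym (fromℤ-suc (+ e)))
    (ℚ.nonNeg+pos⇒pos (fromℕ e) {{fromℕ-nonNeg e}} 1ℚ)
  δ-spec : ∃[ δ ] (0ℚ <ℚ δ × fromℕ (suc e) *ℚ δ ≡ ⅓)
  δ-spec = shrink (fromℕ (suc e)) ⅓ D>0 (ℚ.positive⁻¹ ⅓)
  δ = proj₁ δ-spec
  0<δ = proj₁ (proj₂ δ-spec)
  instance
    δ≥0 : NonNegative δ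
    δ≥0 = nonNegative (ℚ.<⇒≤ 0<δ)
  ϑ = 1ℚ -ℚ δ
  δ≤⅓ : δ ≤ℚ ⅓
  δ≤⅓ = subst (δ ≤ℚ_)
    (trans (solve 2 (λ n d → d :+ n :* d := (n :+ con 1ℚ) :* d) refl (fromℕ e) δ)
      (trans (cong (_*ℚ δ) (sym (fromℤ-suc (+ e)))) (proj₂ (proj₂ δ-spec))))
    (p≤p+q δ (fromℕ e *ℚ δ) (ℚ.nonNeg*nonNeg⇒nonNeg (fromℕ e) {{fromℕ-nonNeg e}} δ))
  ⅔≤ϑ : ⅔ ≤ℚ ϑ
  ⅔≤ϑ = ℚ.+-monoʳ-≤ 1ℚ (ℚ.neg-antimono-≤ δ≤⅓)
  0<ϑ : 0ℚ <ℚ ϑ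
  0<ϑ = ℚ.<-≤-trans (ℚ.positive⁻¹ ⅔) ⅔≤ϑ
  ϑ<1 : ϑ <ℚ 1ℚ
  ϑ<1 = ℚ.+-monoʳ-< 1ℚ (ℚ.neg-antimono-< 0<δ)
  instance
    ϑ≥0 : NonNegative ϑ
    ϑ≥0 = nonNegative (ℚ.<⇒≤ 0<ϑ)
  ⅔≤ϑ^D : ⅔ ≤ℚ ϑ ^ suc e
  ⅔≤ϑ^D = subst (λ z → 1ℚ -ℚ z ≤ℚ ϑ ^ suc e) (proj₂ (proj₂ δ-spec))
    (bernoulli (ℚ.<⇒≤ 0<δ) (ℚ.≤-trans δ≤⅓ (p≤p+q ⅓ ⅔ _)) (suc e))
  bound : ∀ L c → c ≤ suc e * L → ⅔ ^ L ≤ℚ ϑ ^ c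
  bound L c c≤DL = begin
    ⅔ ^ L             ≤⟨ ^-monoˡ-≤ {{_}} {{^-nonNeg ϑ (suc e)}} ⅔≤ϑ^D L ⟩
    (ϑ ^ suc e) ^ L   ≡⟨ ^-assocʳ ϑ (suc e) L ⟩
    ϑ ^ (suc e * L)   ≤⟨ ^-antimonoʳ-≤ (ℚ.<⇒≤ ϑ<1) c≤DL ⟩
    ϑ ^ c             ∎
    where open ℚ.≤-Reasoning

agree⇒𝒱 : ∀ x ϑ a c L → 2 ≤ a → a < c → Agree (word x) a c L → ⅔ ^ L ≤ℚ ϑ ^ c → 𝒱 (K x) ϑ (a , c)
agree⇒𝒱 x ϑ a c L 2≤a a<c agree ⅔^L≤ϑ^c = 2≤a , a<c , λ ε 0<ε →
  -- From this index on, the partial sum contains the L letters after `a` as well as those after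
  -- `c`, and the bound holds even before ε is added.
  L + c , λ n L+c≤n → ℚ.≤-trans
    (agree⇒near x a c L n agree (ℕ.≤-trans (ℕ.+-monoʳ-≤ L (ℕ.<⇒≤ a<c)) L+c≤n) L+c≤n)
    (ℚ.≤-trans ⅔^L≤ϑ^c (p≤p+q (ϑ ^ c) ε (nonNegative (ℚ.<⇒≤ 0<ε))))

-- Periods and collisions of factors.

Agree-multiple : ∀ w a d L k → Agree w a (d + a) (L + k * d) → Agree w a (k * d + a) L
Agree-multiple w a d L zero    agree i i<L = refl
Agree-multiple w a d L (suc k) agree i i<L = trans
  (Agree-multiple w a d L k
    (Agree-≤ {w} {a} {d + a} (ℕ.+-monoʳ-≤ L (ℕ.m≤n+m (k * d) d)) agree) i i<L)
  (trans (cong w (sym (ℕ.+-assoc i (k * d) a)))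
    -- One more shift by d, read at offset i + k d: the extra letters of agreement in the hypothesis
    -- keep this offset in range.
    (trans (agree (i + k * d) (ℕ.+-mono-<-≤ i<L (ℕ.m≤n+m (k * d) d)))
      (cong w (solve 4 (λ i kd d a → (i :+ kd) :+ (d :+ a) := i :+ ((d :+ kd) :+ a))
        refl i (k * d) d a))))
  where open ℕ-Solver

Collision : (ℕ → ℕ) → ℕ → ℕ → Set
Collision w m N = ∃[ a ] ∃[ c ] (2 ≤ a × a < c × c ≤ 2 + N × Agree w a c m)

factor≡⇒Agree : ∀ w m a c → factor w m a ≡ factor w m c → Agree w a c m
factor≡⇒Agree w m a c eq i i<m = begin
  w (i + a)                          ≡⟨ letter a ⟨
  lookup (factor w m a) (fromℕ< i<m) ≡⟨ cong (λ v → lookup v (fromℕ< i<m)) eq ⟩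
  lookup (factor w m c) (fromℕ< i<m) ≡⟨ letter c ⟩
  w (i + c)                          ∎
  where
  open ≡-Reasoning
  letter : ∀ b → lookup (factor w m b) (fromℕ< i<m) ≡ w (i + b)
  letter b = trans (Vec.lookup∘tabulate (λ j → w (b + toℕ j)) (fromℕ< i<m))
    (cong w (trans (cong (_+_ b) (Fin.toℕ-fromℕ< i<m)) (ℕ.+-comm b i)))

-- The positions 2, ..., N + 2 are N + 1 in number, just what `MoreThan N` asks for: without a
-- collision among them, their factors are the witness. A finite search decides between the cases.
complex⊎collision : ∀ w m N → ComplexityExceeds w m N ⊎ Collision w m N
complex⊎collision w m N
  with Fin.any? (λ i → Fin.any? (λ j → (i Fin.<? j) ×-dec
         Vec.≡-dec ℕ._≟_ (factor w m (2 + toℕ i)) (factor w m (2 + toℕ j))))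
... | yes (i , j , i<j , eq) = inj₂
  ( 2 + toℕ i , 2 + toℕ j , ℕ.m≤m+n 2 (toℕ i) , s≤s (s≤s i<j)
  , s≤s (s≤s (Fin.toℕ≤pred[n] j)) , factor≡⇒Agree w m _ _ eq)
... | no ¬clash = inj₁ ((λ i → factor w m (2 + toℕ i)) , injective , λ i → 2 + toℕ i , refl)
  where
  injective : ∀ {i j} → factor w m (2 + toℕ i) ≡ factor w m (2 + toℕ j) → i ≡ j
  injective {i} {j} eq with Fin.<-cmp i j
  ... | tri< i<j _ _ = contradiction (i , j , i<j , eq) ¬clash
  ... | tri≈ _ i≡j _ = i≡j
  ... | tri> _ _ j<i = contradiction (j , i , j<i , sym eq) ¬clash

-- A run of period d is also a run of period k d, so a short gap can be traded for
-- one larger than B at the cost of at most half of the agreement.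
wide-collision : ∀ w C B → let M = suc B * suc B in Collision w (M + M) (C * (M + M)) →
  ∃[ a ] ∃[ c ] (2 ≤ a × a < c × B < c ∸ a × c ≤ (3 + 2 * C) * M × Agree w a c M)
wide-collision w C B (a , c , 2≤a , a<c , c≤ , agree) = split (suc B ℕ.≤? d)
  where
  M = suc B * suc B
  k = suc B
  d = c ∸ a
  -- The summand M leaves room to move the right end to `k * d + a`. The 2 in c ≤ 2 + 2 C M is
  -- absorbed into 2 M, whence the factor 3 + 2 C.
  M+c≤ : M + c ≤ (3 + 2 * C) * M
  M+c≤ = begin
    M + c                       ≤⟨ ℕ.+-monoʳ-≤ M c≤ ⟩
    M + (2 + C * (M + M))       ≤⟨ ℕ.+-monoʳ-≤ M (ℕ.+-monoˡ-≤ (C * (M + M)) (ℕ.*-monoʳ-≤ 2 (s≤s z≤n))) ⟩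
    M + (2 * M + C * (M + M))   ≡⟨ solve 2 (λ m c → m :+ (con 2 :* m :+ c :* (m :+ m))
                                     := (con 3 :+ con 2 :* c) :* m) refl M C ⟩
    (3 + 2 * C) * M             ∎
    where
    open ℕ.≤-Reasoning
    open ℕ-Solver
  B<kd : B < k * d
  B<kd = ℕ.m≤m*n k d {{>-nonZero (ℕ.m<n⇒0<n∸m a<c)}}
  split : Dec (B < d) → ∃[ a ] ∃[ c ] (2 ≤ a × a < c × B < c ∸ a × c ≤ (3 + 2 * C) * M × Agree w a c M)
  split (yes B<d) = a , c , 2≤a , a<c , B<d
    , ℕ.≤-trans (ℕ.m≤n+m c M) M+c≤ , Agree-≤ {w} {a} {c} (ℕ.m≤m+n M M) agree
  split (no B≮d)  = a , k * d + a , 2≤a , ℕ.m<n+m a (ℕ.≤-trans (s≤s z≤n) B<kd)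
    , subst (B <_) (sym (ℕ.m+n∸n≡m (k * d) a)) B<kd
    , ℕ.≤-trans (ℕ.+-mono-≤ kd≤M (ℕ.<⇒≤ a<c)) M+c≤
    , Agree-multiple w a d M k
        (Agree-≤ {w} {a} {d + a} (ℕ.+-monoʳ-≤ M kd≤M)
          (subst (λ b → Agree w a b (M + M)) (sym (ℕ.m∸n+n≡m (ℕ.<⇒≤ a<c))) agree))
    where
    -- As d is at most B + 1, the shift k d is at most (B + 1)², which explains the square in M: of
    -- the 2 M letters, M remain.
    kd≤M : k * d ≤ M
    kd≤M = ℕ.*-monoʳ-≤ k (ℕ.<⇒≤ (ℕ.≰⇒> B≮d))

-- Selection of pairs with distinct gaps.

MoreGaps : Pred (ℕ × ℕ) 0ℓ → ℕ → Set
MoreGaps S B = ∃[ p ] (S p × B < gap p)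

gaps-bounded : ∀ xs → ∃[ g ] (∀ {p} → p ∈ xs → gap p ≤ g)
gaps-bounded xs = gap (argmax gap (0 , 0) xs) , All.lookup (f[xs]≤f[argmax] {f = gap} (0 , 0) xs)

-- Greedily selecting pairs of increasing gap gives a set with distinct gaps;
-- its finiteness forces some stage of the selection to return the goal instead.
exhaust-gaps : ∀ {G : Set} {S : Pred (ℕ × ℕ) 0ℓ} →
  ((T : Pred (ℕ × ℕ) 0ℓ) → T ⊆ S → PairwiseDistinctGaps T → Finite T) →
  (∀ B → G ⊎ MoreGaps S B) → G
exhaust-gaps {G} {S} finite step = conclude (finite T T⊆S distinct)
  where
  next : ∀ {B} → G ⊎ MoreGaps S B → ℕ
  -- A default for stages that return the goal: being above B, it keeps the thresholds strictly
  -- increasing.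
  next {B} (inj₁ _)       = suc B
  next     (inj₂ (p , _)) = gap p

  <next : ∀ {B} (s : G ⊎ MoreGaps S B) → B < next s
  <next (inj₁ _)             = ℕ.≤-refl
  <next (inj₂ (_ , _ , B<g)) = B<g

  threshold : ℕ → ℕ
  threshold zero    = 0
  threshold (suc n) = next (step (threshold n))

  -- The equation excludes the stages that return the goal and makes each stage determine its pair.
  T : Pred (ℕ × ℕ) 0ℓ
  T p = ∃[ n ] ∃[ q ] (step (threshold n) ≡ inj₂ (p , q))

  T⊆S : T ⊆ S
  T⊆S (_ , (Sp , _) , _) = Sp

  gap≡ : ∀ {p} ((n , _) : T p) → gap p ≡ threshold (suc n)
  gap≡ (n , q , eq) = cong next (sym eq)

  threshold-mono : ∀ {m n} → m <′ n → threshold m < threshold n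
  threshold-mono {m} ≤′-refl        = <next (step (threshold m))
  threshold-mono (≤′-step {n} m<n) = ℕ.<-trans (threshold-mono m<n) (<next (step (threshold n)))

  n≤threshold : ∀ n → n ≤ threshold n
  n≤threshold zero    = z≤n
  n≤threshold (suc n) = ℕ.≤-trans (s≤s (n≤threshold n)) (<next (step (threshold n)))

  distinct : PairwiseDistinctGaps T
  distinct s∈T@(m , _ , eqₘ) t∈T@(n , _ , eqₙ) s≢t gap≡gap with ℕ.<-cmp m n
  -- Equal gaps would make the thresholds of stages m + 1 and n + 1 equal, against their strict
  -- growth.
  ... | tri< m<n _ _ = ℕ.<⇒≢ (threshold-mono (ℕ.<⇒<′ (s≤s m<n)))
                         (trans (sym (gap≡ s∈T)) (trans gap≡gap (gap≡ t∈T)))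
  ... | tri> _ _ n<m = ℕ.<⇒≢ (threshold-mono (ℕ.<⇒<′ (s≤s n<m)))
                         (trans (sym (gap≡ t∈T)) (trans (sym gap≡gap) (gap≡ s∈T)))
  ... | tri≈ _ refl _ with refl ← trans (sym eqₘ) eqₙ = s≢t refl

  conclude : Finite T → G
  -- Stage g is decisive: a pair found there lies in T, so its gap is at most g, yet it exceeds
  -- `threshold g` ≥ g.
  conclude (xs , T⊆xs) = stage (step (threshold g)) refl
    where
    g = proj₁ (gaps-bounded xs)
    stage : (s : G ⊎ MoreGaps S (threshold g)) → step (threshold g) ≡ s → G
    stage (inj₁ goal)                _  = goal
    stage (inj₂ (p , q@(_ , t<gap))) eq = contradiction
      (ℕ.≤-<-trans (proj₂ (gaps-bounded xs) (T⊆xs (g , q , eq))) (ℕ.≤-<-trans (n≤threshold g) t<gap))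
      (ℕ.<-irrefl refl)

theorem5p15 : (x₀ : ℕ) → 1 ≤ x₀ →
    ((ϑ : ℚ) → 0ℚ <ℚ ϑ → ϑ <ℚ 1ℚ →
    (T : Pred (ℕ × ℕ) 0ℓ) → T ⊆ 𝒱 (K x₀) ϑ → PairwiseDistinctGaps T → Finite T) →
    Algebraic (K x₀) →
    (C : ℕ) → ∃[ m ] (1 ≤ m × ComplexityExceeds (word x₀) m (C * m))
theorem5p15 x₀ _ finite _ C = exhaust-gaps (finite ϑ 0<ϑ ϑ<1) step
  where
  -- The successor in `∃-base` turns this into the factor 3 + 2 C of `wide-collision`.
  base = ∃-base (2 + 2 * C)
  ϑ = proj₁ base
  0<ϑ = proj₁ (proj₂ base)
  ϑ<1 = proj₁ (proj₂ (proj₂ base))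
  ⅔^≤ϑ^ = proj₂ (proj₂ (proj₂ base))
  step : ∀ B → (∃[ m ] (1 ≤ m × ComplexityExceeds (word x₀) m (C * m))) ⊎ MoreGaps (𝒱 (K x₀) ϑ) B
  -- Since ϑ depends on C alone, one set `𝒱` receives the pairs for all B; only the factor length 2
  -- M grows with B.
  step B = Sum.map
    (λ complex → M + M , s≤s z≤n , complex)
    (λ collision →
      let a , c , 2≤a , a<c , B<gap , c≤ , agree = wide-collision (word x₀) C B collision
      in (a , c) , agree⇒𝒱 x₀ ϑ a c M 2≤a a<c agree (⅔^≤ϑ^ M c c≤) , B<gap)
    (complex⊎collision (word x₀) (M + M) (C * (M + M)))
    where M = suc B * suc B
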